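{- Consider any instance of the Colored Knapsack Problem (ColKP) with $w_i\le b$ and $-p_{\max}<p_i\le p_{\max}$ for all items $i\in\mathcal I$, where $p_{\max}=\max\{p_i:i\in\mathcal I\}>0$. Let $S$ be an optimal ColKP solution containing an item $i$ with $p_i<0$. Then $S$ has a unique dominant color, which is also critical, i.e. $|S|=2d(S)-1$. Furthermore, $S$ contains at most $d(S)-1\le(n-1)/2$ items of negative profit.
   Context: ColKP instance: items $\mathcal I=\{1,\dots,n\}$, capacity $b\in\mathbb Z_{>0}$, colors $\mathcal C=\{1,\dots,m\}$; each item $i$ has weight $w_i\in\mathbb Z_{>0}$, profit $p_i\in\mathbb Z$ and color $\kappa_i\in\mathcal C$. For $S\subseteq\mathcal I$: $w(S)=\sum_{i\in S}w_i$, $p(S)=\sum_{i\in S}p_i$, $\mathcal I_c=\{i\in\mathcal I:\kappa_i=c\}$, $k_c(S)=|S\cap\mathcal I_c|$, $d(S)=\max_{c\in\mathcal C}k_c(S)$. $S$ is feasible if $w(S)\le b$ and $2d(S)\le|S|+1$. An optimal solution is a feasible $S$ maximizing $p(S)$. A color $c$ is dominant in $S$ if $k_c(S)=d(S)$; a dominant color $c$ is critical for $S$ if $k_c(S)=|S\setminus\mathcal I_c|+1$. -}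

module Defs where

open import Algebra.Properties.CommutativeMonoid.Sum using (sum)
open import Data.Bool.Base using (if_then_else_)
open import Data.Fin.Base using (Fin)
open import Data.Fin.Properties using (_≟_)
open import Data.Fin.Subset using (Subset; _∩_; _─_; ∣_∣)
open import Data.Integer.Base as ℤ using (ℤ; 0ℤ)
import Data.Integer.Properties as ℤ
open import Data.Nat.Base using (ℕ; _+_; _*_; _≤_; _<_; _⊔_)
import Data.Nat.Properties as ℕ
open import Data.Product.Base using (_×_; ∃-syntax)
open import Data.Vec.Base using (lookup; tabulate)
import Data.Vec.Functional as Vector
open import Relation.Binary.PropositionalEquality using (_≡_)
open import Relation.Nullary.Decidable using (does)

-- Items are Fin n and colors are Fin m.
record ColKP (n m : ℕ) : Set where
  field
    b   : ℕ
    b>0 : 0 < b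
    w   : Fin n → ℕ
    w>0 : ∀ i → 0 < w i
    p   : Fin n → ℤ
    κ   : Fin n → Fin m

  weight : Subset n → ℕ
  weight S = sum ℕ.+-0-commutativeMonoid (λ i → if lookup S i then w i else 0)

  profit : Subset n → ℤ
  profit S = sum ℤ.+-0-commutativeMonoid (λ i → if lookup S i then p i else 0ℤ)

  colorClass : Fin m → Subset n
  colorClass c = tabulate (λ i → does (κ i ≟ c))

  k : Fin m → Subset n → ℕ
  k c S = ∣ S ∩ colorClass c ∣

  -- The seed 0 never exceeds the maximum, since the k c S are natural numbers;
  -- it is the value only when there are no colors (hence no items) or S is empty.
  d : Subset n → ℕ
  d S = Vector.foldr _⊔_ 0 (λ c → k c S)

  Feasible : Subset n → Set
  Feasible S = weight S ≤ b × 2 * d S ≤ ∣ S ∣ + 1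

  Optimal : Subset n → Set
  Optimal S = Feasible S × (∀ T → Feasible T → profit T ℤ.≤ profit S)

  Dominant : Subset n → Fin m → Set
  Dominant S c = k c S ≡ d S

  Critical : Subset n → Fin m → Set
  Critical S c = Dominant S c × k c S ≡ ∣ S ─ colorClass c ∣ + 1

  -- A relation rather than a function, because there is no maximum when n = 0.
  IsMaxProfit : ℤ → Set
  IsMaxProfit q = (∃[ i ] p i ≡ q) × (∀ i → p i ℤ.≤ q)

  negativeItems : Subset n
  negativeItems = tabulate (λ i → does (p i ℤ.<? 0ℤ))

{-# OPTIONS --safe #-}

-- Dropping a negative item from S raises the profit, so S minus that item is
-- infeasible; as its weight is smaller, the color constraint must break, which
-- forces 2 d(S) = |S| + 1 and leaves d unchanged. Tightness makes the dominant
-- color unique and critical. Since d is unchanged, no negative item has the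
-- dominant color, so all negative items lie among the other d(S) - 1 items.

module Submission where

open import Defs
open import Algebra.Bundles using (CommutativeMonoid)
import Algebra.Properties.CommutativeMonoid.Sum as Sum
import Algebra.Properties.CommutativeSemigroup as CommutativeSemigroup
open import Data.Bool.Base using (true; if_then_else_)
open import Data.Fin.Base using (Fin; zero; suc)
import Data.Fin.Properties as Fin
open import Data.Fin.Subset using (Subset; inside; outside; _∈_; _∉_; _⊆_; _∩_; _─_; ∣_∣)
  renaming (_-_ to _∖_)
open import Data.Fin.Subset.Properties
open import Data.Integer.Base using (ℤ; +_; 0ℤ; 1ℤ; -_; _-_; _*_; _≤_; _<_; +≤+)
import Data.Integer.Properties as ℤ
open import Data.Nat.Base as ℕ using (ℕ; _⊔_)
import Data.Nat.Properties as ℕ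
open import Data.Product using (_×_; _,_; proj₁; proj₂; ∃!; ∃-syntax)
open import Data.Rational.Unnormalised.Base as ℚᵘ using (_/_; *≤*)
open import Data.Sum.Base using (inj₁; inj₂)
open import Data.Vec.Base using ([]; _∷_; lookup; tabulate; here; there)
import Data.Vec.Functional as Vector
open import Data.Vec.Properties using ([]=⇒lookup; lookup⇒[]=; lookup∘tabulate)
open import Function.Base using (_∘_)
open import Relation.Binary.PropositionalEquality
  using (_≡_; _≢_; refl; sym; trans; cong; subst; subst₂; module ≡-Reasoning)
open import Relation.Nullary using (Dec; yes; no; does; contradiction)
open import Relation.Nullary.Decidable using (dec-true)
open import Relation.Unary using (Pred; Decidable)

module _ {c ℓ} (M : CommutativeMonoid c ℓ) where
  open CommutativeMonoid M using (Carrier; _≈_; _∙_; ε; ∙-congˡ; identityˡ; commutativeSemigroup)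
    renaming (sym to ≈-sym; trans to ≈-trans)
  open CommutativeSemigroup commutativeSemigroup using (x∙yz≈y∙xz)
  open Sum M using (sum)

  -- Over the additive monoids of `ℕ` and `ℤ` this unfolds to `weight` and `profit`, so one removal
  -- law serves both.
  subsetSum : ∀ {n} → (Fin n → Carrier) → Subset n → Carrier
  subsetSum f p = sum (λ i → if lookup p i then f i else ε)

  subsetSum-remove : ∀ {n} (f : Fin n → Carrier) {p x} → x ∈ p →
                     subsetSum f p ≈ f x ∙ subsetSum f (p ∖ x)
  subsetSum-remove f {_ ∷ p} here =
    -- Removing the head leaves the tail as `p` minus the empty subset, which equals `p` only
    -- propositionally.
    ∙-congˡ (subst (λ q → subsetSum (f ∘ suc) p ≈ ε ∙ subsetSum (f ∘ suc) q)
      (sym (p─⊥≡p p)) (≈-sym (identityˡ _)))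
  subsetSum-remove f (there x∈p) =
    ≈-trans (∙-congˡ (subsetSum-remove (f ∘ suc) x∈p)) (x∙yz≈y∙xz _ _ _)

module _ {n : ℕ} {ℓ} {P : Pred (Fin n) ℓ} (P? : Decidable P) where

  ∈-tabulate⁺ : ∀ {x} → P x → x ∈ tabulate (does ∘ P?)
  ∈-tabulate⁺ {x} px = lookup⇒[]= x _ (trans (lookup∘tabulate _ x) (dec-true (P? x) px))

  ∈-tabulate⁻ : ∀ {x} → x ∈ tabulate (does ∘ P?) → P x
  ∈-tabulate⁻ {x} x∈ = witness (P? x) (trans (sym (lookup∘tabulate _ x)) ([]=⇒lookup x∈))
    where
    witness : ∀ {a} {A : Set a} (a? : Dec A) → does a? ≡ true → A
    witness (yes a) _ = a

∣p∣≡1+∣p∖x∣ : ∀ {n} {p : Subset n} {x} → x ∈ p → ∣ p ∣ ≡ ℕ.suc ∣ p ∖ x ∣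
∣p∣≡1+∣p∖x∣ {p = _ ∷ p}       here        = cong (ℕ.suc ∘ ∣_∣) (sym (p─⊥≡p p))
∣p∣≡1+∣p∖x∣ {p = inside ∷ _}  (there x∈p) = cong ℕ.suc (∣p∣≡1+∣p∖x∣ x∈p)
∣p∣≡1+∣p∖x∣ {p = outside ∷ _} (there x∈p) = ∣p∣≡1+∣p∖x∣ x∈p

∣p∩q∣+∣p─q∣≡∣p∣ : ∀ {n} (p q : Subset n) → ∣ p ∩ q ∣ ℕ.+ ∣ p ─ q ∣ ≡ ∣ p ∣
∣p∩q∣+∣p─q∣≡∣p∣ []            []            = refl
∣p∩q∣+∣p─q∣≡∣p∣ (inside ∷ p)  (inside ∷ q)  = cong ℕ.suc (∣p∩q∣+∣p─q∣≡∣p∣ p q)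
∣p∩q∣+∣p─q∣≡∣p∣ (inside ∷ p)  (outside ∷ q) =
  trans (ℕ.+-suc _ _) (cong ℕ.suc (∣p∩q∣+∣p─q∣≡∣p∣ p q))
∣p∩q∣+∣p─q∣≡∣p∣ (outside ∷ p) (inside ∷ q)  = ∣p∩q∣+∣p─q∣≡∣p∣ p q
∣p∩q∣+∣p─q∣≡∣p∣ (outside ∷ p) (outside ∷ q) = ∣p∩q∣+∣p─q∣≡∣p∣ p q

-- The fold inside `d`: `d S` is by definition the `maximum` of `k c S` over the colors `c`.
maximum : ∀ {m} → Vector.Vector ℕ m → ℕ
maximum = Vector.foldr _⊔_ 0

≤-maximum : ∀ {m} (t : Vector.Vector ℕ m) c → t c ℕ.≤ maximum t
≤-maximum t zero    = ℕ.m≤m⊔n _ _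
≤-maximum t (suc c) = ℕ.≤-trans (≤-maximum (t ∘ suc) c) (ℕ.m≤n⊔m _ _)

maximum-lub : ∀ {m} (t : Vector.Vector ℕ m) {u} → (∀ c → t c ℕ.≤ u) → maximum t ℕ.≤ u
maximum-lub {ℕ.zero}  t t≤u = ℕ.z≤n
maximum-lub {ℕ.suc m} t t≤u = ℕ.⊔-lub (t≤u zero) (maximum-lub (t ∘ suc) (t≤u ∘ suc))

-- Positivity excludes the empty vector, whose maximum is the seed `0` and is no entry. It passes to
-- the tail whenever the tail supplies the maximum.
maximum-attained : ∀ {m} (t : Vector.Vector ℕ m) → 0 ℕ.< maximum t → ∃[ c ] t c ≡ maximum t
maximum-attained {ℕ.suc m} t 0<max with ℕ.⊔-sel (t zero) (maximum (t ∘ suc))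
... | inj₁ eq = zero , sym eq
... | inj₂ eq with c , tc≡ ← maximum-attained (t ∘ suc) (subst (0 ℕ.<_) eq 0<max) =
  suc c , trans tc≡ (sym eq)

[m+1]-1≡m : ∀ m → + (m ℕ.+ 1) - 1ℤ ≡ + m
[m+1]-1≡m m = trans (ℤ.+-assoc (+ m) 1ℤ (- 1ℤ)) (ℤ.+-identityʳ (+ m))

module _ {n m : ℕ} (I : ColKP n m) where
  open ColKP I

  Tight : Subset n → Set
  Tight S = 2 ℕ.* d S ≡ ∣ S ∣ ℕ.+ 1

  k-mono : ∀ c S T → S ⊆ T → k c S ℕ.≤ k c T
  k-mono c S T S⊆T = p⊆q⇒∣p∣≤∣q∣ λ x∈ →
    let x∈S , x∈C = x∈p∩q⁻ S (colorClass c) x∈ in x∈p∩q⁺ (S⊆T x∈S , x∈C)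

  d-mono : ∀ S T → S ⊆ T → d S ℕ.≤ d T
  d-mono S T S⊆T =
    maximum-lub (λ c → k c S) λ c → ℕ.≤-trans (k-mono c S T S⊆T) (≤-maximum (λ c → k c T) c)

  -- The inclusion of the color parts is strict, with `i` itself as the witness.
  k-remove : ∀ {S i} c → i ∈ S → κ i ≡ c → k c (S ∖ i) ℕ.< k c S
  k-remove {S} {i} c i∈S κi≡c = p⊂q⇒∣p∣<∣q∣
    ( (λ x∈ → let x∈S , x∈C = x∈p∩q⁻ (S ∖ i) (colorClass c) x∈ in x∈p∩q⁺ (p─q⊆p S _ x∈S , x∈C))
    , i
    , x∈p∩q⁺ (i∈S , ∈-tabulate⁺ (λ j → κ j Fin.≟ c) κi≡c)
    , λ i∈ → x∉p∖x (proj₁ (x∈p∩q⁻ (S ∖ i) (colorClass c) i∈)) )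
    where
    x∉p∖x : ∀ {n} {p : Subset n} {x} → x ∉ p ∖ x
    x∉p∖x {p = _ ∷ _} {zero} ()
    x∉p∖x {p = _ ∷ _} {suc x} (there x∈) = x∉p∖x x∈

  weight-remove : ∀ {S i} → i ∈ S → weight (S ∖ i) ℕ.≤ weight S
  weight-remove {i = i} i∈S =
    ℕ.≤-trans (ℕ.m≤n+m _ (w i)) (ℕ.≤-reflexive (sym (subsetSum-remove ℕ.+-0-commutativeMonoid w i∈S)))

  profit-remove : ∀ {S i} → i ∈ S → p i < 0ℤ → profit S < profit (S ∖ i)
  profit-remove {S} {i} i∈S pi<0 =
    subst₂ _<_ (sym (subsetSum-remove ℤ.+-0-commutativeMonoid p i∈S)) (ℤ.+-identityˡ _)
      (ℤ.+-monoˡ-< (profit (S ∖ i)) pi<0)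

  module _ {S : Subset n} (optimal : Optimal S) {i : Fin n} (i∈S : i ∈ S) (pi<0 : p i < 0ℤ) where

    -- Otherwise `S ∖ i` would be feasible and more profitable than the optimal `S`. The bound
    -- `∣ S ∣` is `∣ S ∖ i ∣ + 1`, the right side of the color constraint for `S ∖ i`.
    remove-breaks-color-constraint : ∣ S ∣ ℕ.< 2 ℕ.* d (S ∖ i)
    remove-breaks-color-constraint = ℕ.≰⇒> λ 2d≤∣S∣ →
      ℤ.<⇒≱ (profit-remove i∈S pi<0) (proj₂ optimal (S ∖ i)
        ( ℕ.≤-trans (weight-remove i∈S) (proj₁ (proj₁ optimal))
        , subst (2 ℕ.* d (S ∖ i) ℕ.≤_) (trans (∣p∣≡1+∣p∖x∣ i∈S) (ℕ.+-comm 1 _)) 2d≤∣S∣ ))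

    d-remove-≤ : d (S ∖ i) ℕ.≤ d S
    d-remove-≤ = d-mono (S ∖ i) S (p─q⊆p S _)

    -- The chain `∣ S ∣ + 1 ≤ 2 * d (S ∖ i) ≤ 2 * d S ≤ ∣ S ∣ + 1` collapses to equalities.
    tight : Tight S
    tight = ℕ.≤-antisym (proj₂ (proj₁ optimal))
      (subst (ℕ._≤ 2 ℕ.* d S) (ℕ.+-comm 1 _)
        (ℕ.≤-trans remove-breaks-color-constraint (ℕ.*-monoʳ-≤ 2 d-remove-≤)))

    -- The same chain, started at `2 * d S`, gives the missing inequality once the factor `2` is
    -- cancelled.
    d-remove : d (S ∖ i) ≡ d S
    d-remove = ℕ.≤-antisym d-remove-≤ (ℕ.*-cancelˡ-≤ 2
      (ℕ.≤-trans (proj₂ (proj₁ optimal))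
        (subst (ℕ._≤ 2 ℕ.* d (S ∖ i)) (ℕ.+-comm 1 _) remove-breaks-color-constraint)))

  module _ {S : Subset n} (S-tight : Tight S) where

    0<d : 0 ℕ.< d S
    0<d = ℕ.*-cancelˡ-< 2 0 (d S) (subst (0 ℕ.<_) (trans (ℕ.+-comm 1 _) (sym S-tight)) ℕ.z<s)

    -- Tightness reads `2 * k c S ≡ ∣ S ∣ + 1`. Splitting `∣ S ∣` into color `c` and the rest, one
    -- copy of `k c S` cancels.
    dominant⇒critical : ∀ {c} → Dominant S c → Critical S c
    dominant⇒critical {c} dom = dom , ℕ.+-cancelˡ-≡ (k c S) _ _ (begin
      k c S ℕ.+ k c S                              ≡⟨ cong (k c S ℕ.+_) (ℕ.+-identityʳ _) ⟨
      2 ℕ.* k c S                                  ≡⟨ cong (2 ℕ.*_) dom ⟩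
      2 ℕ.* d S                                    ≡⟨ S-tight ⟩
      ∣ S ∣ ℕ.+ 1                                  ≡⟨ cong (ℕ._+ 1) (∣p∩q∣+∣p─q∣≡∣p∣ S (colorClass c)) ⟨
      k c S ℕ.+ ∣ S ─ colorClass c ∣ ℕ.+ 1         ≡⟨ ℕ.+-assoc (k c S) _ 1 ⟩
      k c S ℕ.+ (∣ S ─ colorClass c ∣ ℕ.+ 1)       ∎)
      where open ≡-Reasoning

    d≡others+1 : ∀ {c} → Dominant S c → d S ≡ ∣ S ─ colorClass c ∣ ℕ.+ 1
    d≡others+1 dom = trans (sym dom) (proj₂ (dominant⇒critical dom))

    -- The `d S` items of a second dominant color would all lie outside color `c`, where `S` has
    -- only `d S - 1` items.
    dominant-unique : ∀ {c c′} → Dominant S c → Dominant S c′ → c ≡ c′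
    dominant-unique {c} {c′} dom dom′ with c Fin.≟ c′
    ... | yes c≡c′ = c≡c′
    ... | no c≢c′ = contradiction (p⊆q⇒∣p∣≤∣q∣ disjoint) (ℕ.<⇒≱ (ℕ.≤-reflexive (begin
      ℕ.suc ∣ S ─ colorClass c ∣   ≡⟨ ℕ.+-comm 1 _ ⟩
      ∣ S ─ colorClass c ∣ ℕ.+ 1   ≡⟨ d≡others+1 dom ⟨
      d S                          ≡⟨ dom′ ⟨
      k c′ S                       ∎)))
      where
      open ≡-Reasoning
      disjoint : S ∩ colorClass c′ ⊆ S ─ colorClass c
      disjoint x∈ = let x∈S , x∈C′ = x∈p∩q⁻ S (colorClass c′) x∈ in
        x∈p∧x∉q⇒x∈p─q x∈S λ x∈C → c≢c′
          (trans (sym (∈-tabulate⁻ (λ j → κ j Fin.≟ c) x∈C)) (∈-tabulate⁻ (λ j → κ j Fin.≟ c′) x∈C′))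

  -- A color attaining `d (S ∖ i)`, which equals `d S`, is also dominant in `S`, hence is `c`. But
  -- if `i` had color `c`, its removal would have lowered the count of `c`.
  negative⇒not-dominant : ∀ {S} → Optimal S → ∀ {i} → i ∈ S → p i < 0ℤ →
                          ∀ {c} → Dominant S c → κ i ≢ c
  negative⇒not-dominant {S} optimal {i} i∈S pi<0 {c} dom κi≡c
    with c′ , kc′≡d ← maximum-attained (λ c → k c (S ∖ i))
           (subst (0 ℕ.<_) (sym (d-remove optimal i∈S pi<0)) (0<d {S} (tight optimal i∈S pi<0))) =
    ℕ.<⇒≱ (k-remove c i∈S κi≡c) (ℕ.≤-reflexive (trans dom (sym kc≡d)))
    where
    kc′≡dS : k c′ (S ∖ i) ≡ d S
    kc′≡dS = trans kc′≡d (d-remove optimal i∈S pi<0)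
    -- Squeeze: `d S ≡ k c′ (S ∖ i) ≤ k c′ S ≤ d S`.
    dom′ : Dominant S c′
    dom′ = ℕ.≤-antisym (≤-maximum (λ c → k c S) c′)
      (subst (ℕ._≤ k c′ S) kc′≡dS (k-mono c′ (S ∖ i) S (p─q⊆p S _)))
    kc≡d : k c (S ∖ i) ≡ d S
    kc≡d = subst (λ c → k c (S ∖ i) ≡ d S) (dominant-unique {S} (tight optimal i∈S pi<0) {c′} {c} dom′ dom) kc′≡dS

  -- Each negative item of `S` can serve as the removed item, so none of them has the dominant
  -- color.
  negatives-bound : ∀ {S} → Optimal S → ∀ {c} → Dominant S c →
                    ∣ S ∩ negativeItems ∣ ℕ.≤ ∣ S ─ colorClass c ∣
  negatives-bound {S} optimal {c} dom = p⊆q⇒∣p∣≤∣q∣ λ x∈ →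
    let x∈S , x∈N = x∈p∩q⁻ S negativeItems x∈ in
    x∈p∧x∉q⇒x∈p─q x∈S
      (negative⇒not-dominant optimal x∈S (∈-tabulate⁻ (λ j → p j ℤ.<? 0ℤ) x∈N) {c} dom
        ∘ ∈-tabulate⁻ (λ j → κ j Fin.≟ c))

lemma2p4 : ∀ {n m : ℕ} (I : ColKP n m) → let open ColKP I in
    (∀ i → w i ℕ.≤ b) →
    (pmax : ℤ) → IsMaxProfit pmax → 0ℤ < pmax →
    (∀ i → (- pmax < p i) × (p i ≤ pmax)) →
    (S : Subset n) → Optimal S →
    (i : Fin n) → i ∈ S → p i < 0ℤ →
    ∃! _≡_ (Dominant S)
    × (∀ c → Dominant S c → Critical S c)
    × (+ ∣ S ∣ ≡ + 2 * + d S - 1ℤ)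
    × (+ ∣ S ∩ negativeItems ∣ ≤ + d S - 1ℤ)
    × ((+ d S - 1ℤ) / 1 ℚᵘ.≤ (+ n - 1ℤ) / 2)
lemma2p4 {n} I _ _ _ _ _ S optimal i i∈S pi<0
  with c , dom ← maximum-attained _ (0<d I {S} (tight I optimal i∈S pi<0)) =
    (c , dom , dominant-unique I {S} S-tight dom)
  , (λ _ → dominant⇒critical I {S} S-tight)
  , ∣S∣≡2d-1
  , subst (+ ∣ S ∩ negativeItems ∣ ≤_) (sym d-1≡e) (+≤+ (negatives-bound I {S} optimal {c} dom))
  -- Cross-multiplied, the rational inequality is `(d S - 1) * 2 ≤ (n - 1) * 1` in `ℤ`, which is
  -- `2 * e + 1 ≤ n` with `1` subtracted.
  , *≤* (subst₂ _≤_ e*2 (sym (ℤ.*-identityʳ _)) (ℤ.+-monoˡ-≤ (- 1ℤ) (+≤+ 1+2e≤n)))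
  where
  open ColKP I
  S-tight : Tight I S
  S-tight = tight I optimal i∈S pi<0
  -- A natural number standing for `d S - 1`, which avoids truncated subtraction.
  e : ℕ
  e = ∣ S ─ colorClass c ∣
  d≡e+1 : d S ≡ e ℕ.+ 1
  d≡e+1 = d≡others+1 I {S} S-tight dom
  d-1≡e : + d S - 1ℤ ≡ + e
  d-1≡e = trans (cong (λ x → + x - 1ℤ) d≡e+1) ([m+1]-1≡m e)
  ∣S∣≡2d-1 : + ∣ S ∣ ≡ + 2 * + d S - 1ℤ
  ∣S∣≡2d-1 = begin
    + ∣ S ∣                  ≡⟨ [m+1]-1≡m ∣ S ∣ ⟨
    + (∣ S ∣ ℕ.+ 1) - 1ℤ     ≡⟨ cong (λ x → + x - 1ℤ) S-tight ⟨
    + (2 ℕ.* d S) - 1ℤ       ≡⟨ cong (_- 1ℤ) (ℤ.pos-* 2 (d S)) ⟩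
    + 2 * + d S - 1ℤ         ∎
    where open ≡-Reasoning
  ∣S∣≡2e+1 : ∣ S ∣ ≡ e ℕ.* 2 ℕ.+ 1
  ∣S∣≡2e+1 = ℕ.+-cancelʳ-≡ 1 _ _ (begin
    ∣ S ∣ ℕ.+ 1            ≡⟨ S-tight ⟨
    2 ℕ.* d S              ≡⟨ cong (2 ℕ.*_) d≡e+1 ⟩
    2 ℕ.* (e ℕ.+ 1)        ≡⟨ ℕ.*-comm 2 (e ℕ.+ 1) ⟩
    (e ℕ.+ 1) ℕ.* 2        ≡⟨ ℕ.*-distribʳ-+ 2 e 1 ⟩
    e ℕ.* 2 ℕ.+ 2          ≡⟨ ℕ.+-assoc (e ℕ.* 2) 1 1 ⟨
    e ℕ.* 2 ℕ.+ 1 ℕ.+ 1    ∎)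
    where open ≡-Reasoning
  1+2e≤n : e ℕ.* 2 ℕ.+ 1 ℕ.≤ n
  1+2e≤n = subst (ℕ._≤ n) ∣S∣≡2e+1 (∣p∣≤n S)
  e*2 : + (e ℕ.* 2 ℕ.+ 1) - 1ℤ ≡ (+ d S - 1ℤ) * + 2
  e*2 = begin
    + (e ℕ.* 2 ℕ.+ 1) - 1ℤ   ≡⟨ [m+1]-1≡m (e ℕ.* 2) ⟩
    + (e ℕ.* 2)              ≡⟨ ℤ.pos-* e 2 ⟩
    + e * + 2                ≡⟨ cong (_* + 2) d-1≡e ⟨
    (+ d S - 1ℤ) * + 2       ∎
    where open ≡-Reasoning
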